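{- Let $e$ and $f$ be edges of $G$. In the spanning subgraph toggle group $T(\mathcal{S}(G))$, $(t_et_f)^2=1$ if and only if no cut-set of $G$ contains both $e$ and $f$.
   Context: $G$ is a graph with vertex set $V(G)$ and finite edge set $E(G)$. A spanning subgraph of $G$ is a subset $S\subseteq E(G)$ of the edges of $G$ such that the subgraph $(V(G),S)$, consisting of all the vertices of $G$ and the edges in $S$, has the same number of connected components as $G$. The ground set is $E(G)$, and $\mathcal{S}(G)\subseteq 2^{E(G)}$ is the set of edge sets of spanning subgraphs. For $e\in E(G)$ the toggle $t_e:\mathcal{S}(G)\to\mathcal{S}(G)$ is given by $t_e(X)=X\cup\{e\}$ if $e\notin X$ and $X\cup\{e\}\in\mathcal{S}(G)$; $t_e(X)=X\setminus\{e\}$ if $e\in X$ and $X\setminus\{e\}\in\mathcal{S}(G)$; and $t_e(X)=X$ otherwise. The spanning subgraph toggle group $T(\mathcal{S}(G))$ is the subgroup of the symmetric group on $\mathcal{S}(G)$ generated by the toggles $t_e$, $e\in E(G)$. A cut of a graph is a partition of the vertices into two disjoint subsets. A cut determines a cut-set (also called a co-circuit), defined as the set of edges that have one endpoint in each subset of the partition.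
   Formalization: The claim fails if cut-set means all edges across any cut (path a-b-c, cut {b}|{a,c}), or if e = f is not a loop, or with infinitely many vertices; here cut-set means co-circuit (minimal nonempty cut-set), e and f are distinct, and the vertex set is finite. -}

module Defs where

open import Algebra.Bundles using (Group)
open import Data.Fin using (Fin; _≟_)
open import Data.Fin.Subset using (Subset; _∈_; _∉_; _⊆_; _∪_; _-_; ⁅_⁆; ∁; ⊤; Nonempty; inside; outside)
open import Data.Fin.Subset.Properties
  using (_∈?_; x∈⁅x⁆; q⊆p∪q; ∪-identityʳ; p─⊥≡p)
open import Data.List using (List; []; _∷_; map; filter; length; deduplicate; allFin)
open import Data.List.Membership.Propositional using () renaming (_∈_ to _∈ₗ_)
open import Data.List.Membership.Propositional.Properties
  using (∈-map⁺; ∈-map⁻; ∈-filter⁺; ∈-filter⁻; ∈-allFin)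
open import Data.List.Relation.Unary.Any using (here; there)
open import Data.Nat using (ℕ)
import Data.Nat.Properties as ℕ
open import Data.Product using (Σ; ∃-syntax; _×_; _,_; proj₁; proj₂)
open import Data.Sum using (_⊎_; inj₁; inj₂)
open import Data.Vec using (_∷_; here; there)
open import Function using (_∘_; _⇔_; _↔_; mk↔ₛ′; Inverse)
open import Function.Construct.Composition using (_↔-∘_)
open import Function.Construct.Identity using (↔-id)
open import Function.Construct.Symmetry using (↔-sym)
open import Level using (0ℓ; _⊔_)
open import Relation.Binary.Construct.Closure.Equivalence as Eq using (EqClosure)
open import Relation.Binary.Construct.Closure.ReflexiveTransitive using (ε; _◅_)
open import Relation.Binary.Construct.Closure.Symmetric using (fwd; bwd)
open import Relation.Binary.Definitions using (Decidable)
open import Relation.Binary.PropositionalEquality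
  using (_≡_; _≗_; refl; sym; trans; cong; subst)
open import Relation.Nullary using (¬_; Dec; yes; no; contradiction)
open import Relation.Nullary.Decidable using (map′; _×-dec_; _⊎-dec_)

-- Edges carry their own names, so loops and parallel edges are allowed.
-- The order of the two endpoints given by `ends` is irrelevant.
record Graph : Set where
  field
    #V #E : ℕ
    ends  : Fin #E → Fin #V × Fin #V

  V E : Set
  V = Fin #V
  E = Fin #E

open Graph public

module _ (G : Graph) where

  Adjacent : Subset (#E G) → V G → V G → Set
  Adjacent S u v = ∃[ e ] (e ∈ S × ends G e ≡ (u , v))

  -- There is a walk from u to v in (V(G), S), edges being traversed in either direction.
  Connected : Subset (#E G) → V G → V G → Set
  Connected S = EqClosure (Adjacent S)

module _ {n : ℕ} where

  Joined : List (Fin n × Fin n) → Fin n → Fin n → Set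
  Joined es u v = (u , v) ∈ₗ es

  private
    Walk : List (Fin n × Fin n) → Fin n → Fin n → Set
    Walk es = EqClosure (Joined es)

    _⁀_ : ∀ {es u v w} → Walk es u v → Walk es v w → Walk es u w
    _⁀_ {es} = Eq.transitive (Joined es)

    rev : ∀ {es u v} → Walk es u v → Walk es v u
    rev {es} = Eq.symmetric (Joined es)

    Split : Fin n → Fin n → List (Fin n × Fin n) → Fin n → Fin n → Set
    Split a b es u v = Walk es u v ⊎ (Walk es u a × Walk es b v) ⊎ (Walk es u b × Walk es a v)

    join : ∀ {a b es u v} → Split a b es u v → Walk ((a , b) ∷ es) u v
    join {a} {b} {es} = λ where
        (inj₁ p)              → up p
        (inj₂ (inj₁ (p , q))) → up p ⁀ (fwd (here refl) ◅ up q)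
        (inj₂ (inj₂ (p , q))) → up p ⁀ (bwd (here refl) ◅ up q)
      where
      up : ∀ {u v} → Walk es u v → Walk ((a , b) ∷ es) u v
      up = Eq.map there

    split : ∀ {a b es u v} → Walk ((a , b) ∷ es) u v → Split a b es u v
    split ε = inj₁ ε
    split (fwd (here refl) ◅ w) with split w
    ... | inj₁ p              = inj₂ (inj₁ (ε , p))
    ... | inj₂ (inj₁ (_ , q)) = inj₂ (inj₁ (ε , q))
    ... | inj₂ (inj₂ (_ , q)) = inj₁ q
    split (bwd (here refl) ◅ w) with split w
    ... | inj₁ p              = inj₂ (inj₂ (ε , p))
    ... | inj₂ (inj₁ (_ , q)) = inj₁ q
    ... | inj₂ (inj₂ (_ , q)) = inj₂ (inj₂ (ε , q))
    split (fwd (there x) ◅ w) with split w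
    ... | inj₁ p              = inj₁ (fwd x ◅ p)
    ... | inj₂ (inj₁ (p , q)) = inj₂ (inj₁ (fwd x ◅ p , q))
    ... | inj₂ (inj₂ (p , q)) = inj₂ (inj₂ (fwd x ◅ p , q))
    split (bwd (there x) ◅ w) with split w
    ... | inj₁ p              = inj₁ (bwd x ◅ p)
    ... | inj₂ (inj₁ (p , q)) = inj₂ (inj₁ (bwd x ◅ p , q))
    ... | inj₂ (inj₂ (p , q)) = inj₂ (inj₂ (bwd x ◅ p , q))

  walk? : ∀ es → Decidable (EqClosure (Joined es))
  walk? []             u v = map′ (λ { refl → ε }) trivial (u ≟ v)
    where
    trivial : ∀ {u v} → Walk [] u v → u ≡ v
    trivial ε             = refl
    trivial (fwd () ◅ _)
    trivial (bwd () ◅ _)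
  walk? ((a , b) ∷ es) u v = map′ join split
    (walk? es u v ⊎-dec (walk? es u a ×-dec walk? es b v) ⊎-dec (walk? es u b ×-dec walk? es a v))

module _ (G : Graph) where

  connected? : ∀ S → Decidable (Connected G S)
  connected? S u v = map′ (Eq.map from) (Eq.map to) (walk? es u v)
    where
    es : List (V G × V G)
    es = map (ends G) (filter (_∈? S) (allFin (#E G)))

    from : ∀ {u v} → Joined es u v → Adjacent G S u v
    from x with ∈-map⁻ (ends G) x
    ... | e , e∈ , eq = e , proj₂ (∈-filter⁻ (_∈? S) {xs = allFin (#E G)} e∈) , sym eq

    to : ∀ {u v} → Adjacent G S u v → Joined es u v
    to (e , e∈S , eq) =
      subst (_∈ₗ es) eq (∈-map⁺ (ends G) (∈-filter⁺ (_∈? S) (∈-allFin e) e∈S))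

  -- `deduplicate` keeps exactly one vertex of each connected component.
  #components : Subset (#E G) → ℕ
  #components S = length (deduplicate (connected? S) (allFin (#V G)))

  IsSpanning : Subset (#E G) → Set
  IsSpanning S = #components S ≡ #components ⊤

  isSpanning? : ∀ S → Dec (IsSpanning S)
  isSpanning? S = #components S ℕ.≟ #components ⊤

  -- Spanning proofs are equalities in ℕ, hence unique: two elements of 𝒮 are
  -- equal as soon as their edge sets are.
  𝒮 : Set
  𝒮 = Σ (Subset (#E G)) IsSpanning

  𝒮-≡ : {X Y : 𝒮} → proj₁ X ≡ proj₁ Y → X ≡ Y
  𝒮-≡ {X , s} {_ , s′} refl = cong (X ,_) (ℕ.≡-irrelevant s s′)

  toggle : E G → 𝒮 → 𝒮
  toggle e (X , s) with e ∈? X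
  toggle e (X , s) | no  e∉X with isSpanning? (X ∪ ⁅ e ⁆)
  ... | yes s′ = X ∪ ⁅ e ⁆ , s′
  ... | no  _  = X , s
  toggle e (X , s) | yes e∈X with isSpanning? (X - e)
  ... | yes s′ = X - e , s′
  ... | no  _  = X , s

x∉p-x : ∀ {n} {x : Fin n} (p : Subset n) → x ∉ p - x
x∉p-x {x = Fin.zero}  (inside  ∷ p) ()
x∉p-x {x = Fin.zero}  (outside ∷ p) ()
x∉p-x {x = Fin.suc x} (_       ∷ p) (there x∈) = x∉p-x p x∈

add-remove : ∀ {n} {x : Fin n} {p : Subset n} → x ∉ p → (p ∪ ⁅ x ⁆) - x ≡ p
add-remove {x = Fin.zero}  {inside  ∷ p} x∉p = contradiction here x∉p
add-remove {x = Fin.zero}  {outside ∷ p} x∉p =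
  cong (outside ∷_) (trans (p─⊥≡p (p ∪ _)) (∪-identityʳ p))
add-remove {x = Fin.suc x} {inside  ∷ p} x∉p = cong (inside  ∷_) (add-remove (x∉p ∘ there))
add-remove {x = Fin.suc x} {outside ∷ p} x∉p = cong (outside ∷_) (add-remove (x∉p ∘ there))

remove-add : ∀ {n} {x : Fin n} {p : Subset n} → x ∈ p → (p - x) ∪ ⁅ x ⁆ ≡ p
remove-add {x = Fin.zero}  {_ ∷ p} here =
  cong (inside ∷_) (trans (∪-identityʳ _) (p─⊥≡p p))
remove-add {x = Fin.suc x} {inside  ∷ p} (there x∈p) = cong (inside  ∷_) (remove-add x∈p)
remove-add {x = Fin.suc x} {outside ∷ p} (there x∈p) = cong (outside ∷_) (remove-add x∈p)

module _ (G : Graph) where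

  toggle-add : ∀ e {X} s → e ∉ X → (s′ : IsSpanning G (X ∪ ⁅ e ⁆)) →
               toggle G e (X , s) ≡ (X ∪ ⁅ e ⁆ , s′)
  toggle-add e {X} s e∉X s′ with e ∈? X
  ... | yes e∈X = contradiction e∈X e∉X
  ... | no  _ with isSpanning? G (X ∪ ⁅ e ⁆)
  ...   | yes _  = 𝒮-≡ G refl
  ...   | no ¬s′ = contradiction s′ ¬s′

  toggle-remove : ∀ e {X} s → e ∈ X → (s′ : IsSpanning G (X - e)) →
                  toggle G e (X , s) ≡ (X - e , s′)
  toggle-remove e {X} s e∈X s′ with e ∈? X
  ... | no  e∉X = contradiction e∈X e∉X
  ... | yes _ with isSpanning? G (X - e)
  ...   | yes _  = 𝒮-≡ G refl
  ...   | no ¬s′ = contradiction s′ ¬s′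

  toggle-add-fix : ∀ e {X} s → e ∉ X → ¬ IsSpanning G (X ∪ ⁅ e ⁆) →
                   toggle G e (X , s) ≡ (X , s)
  toggle-add-fix e {X} s e∉X ¬s′ with e ∈? X
  ... | yes e∈X = contradiction e∈X e∉X
  ... | no  _ with isSpanning? G (X ∪ ⁅ e ⁆)
  ...   | yes s′ = contradiction s′ ¬s′
  ...   | no _   = refl

  toggle-remove-fix : ∀ e {X} s → e ∈ X → ¬ IsSpanning G (X - e) →
                      toggle G e (X , s) ≡ (X , s)
  toggle-remove-fix e {X} s e∈X ¬s′ with e ∈? X
  ... | no  e∉X = contradiction e∈X e∉X
  ... | yes _ with isSpanning? G (X - e)
  ...   | yes s′ = contradiction s′ ¬s′
  ...   | no _   = refl

  toggle-involutive : ∀ e X → toggle G e (toggle G e X) ≡ X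
  toggle-involutive e (X , s) = go (e ∈? X) (isSpanning? G (X ∪ ⁅ e ⁆)) (isSpanning? G (X - e))
    where
    t = toggle G e

    go : Dec (e ∈ X) → Dec (IsSpanning G (X ∪ ⁅ e ⁆)) → Dec (IsSpanning G (X - e)) →
         t (t (X , s)) ≡ (X , s)
    go (no e∉X) (yes s′) _ =
      trans (cong t (toggle-add e s e∉X s′))
      (trans (toggle-remove e s′ (q⊆p∪q X ⁅ e ⁆ (x∈⁅x⁆ e)) (subst (IsSpanning G) (sym (add-remove e∉X)) s))
             (𝒮-≡ G (add-remove e∉X)))
    go (no e∉X) (no ¬s′) _ = trans (cong t fix) fix
      where fix = toggle-add-fix e s e∉X ¬s′
    go (yes e∈X) _ (yes s′) =
      trans (cong t (toggle-remove e s e∈X s′))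
      (trans (toggle-add e s′ (x∉p-x X) (subst (IsSpanning G) (sym (remove-add e∈X)) s))
             (𝒮-≡ G (remove-add e∈X)))
    go (yes e∈X) _ (no ¬s′) = trans (cong t fix) fix
      where fix = toggle-remove-fix e s e∈X ¬s′

  toggle-↔ : E G → 𝒮 G ↔ 𝒮 G
  toggle-↔ e = mk↔ₛ′ (toggle G e) (toggle G e) (toggle-involutive e) (toggle-involutive e)

SymmetricGroup : ∀ {a} → Set a → Group a a
SymmetricGroup A = record
  { Carrier = A ↔ A
  ; _≈_     = λ π ρ → to π ≗ to ρ
  ; _∙_     = λ π ρ → π ↔-∘ ρ
  ; ε       = ↔-id A
  ; _⁻¹     = ↔-sym
  ; isGroup = record
    { isMonoid = record
      { isSemigroup = record
        { isMagma = record
          { isEquivalence = record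
            { refl  = λ _ → refl
            ; sym   = λ p x → sym (p x)
            ; trans = λ p q x → trans (p x) (q x)
            }
          ; ∙-cong = λ {_} {π′} {ρ} p q x → trans (p (to ρ x)) (cong (to π′) (q x))
          }
        ; assoc = λ _ _ _ _ → refl
        }
      ; identity = (λ _ _ → refl) , (λ _ _ → refl)
      }
    ; inverse = strictlyInverseʳ , strictlyInverseˡ
    ; ⁻¹-cong = λ {π} {ρ} p x →
        trans (cong (from π) (sym (strictlyInverseˡ ρ x)))
        (trans (cong (from π) (sym (p (from ρ x))))
               (strictlyInverseʳ π (from ρ x)))
    }
  }
  where open Inverse

module _ {c ℓ i} (𝔾 : Group c ℓ) {I : Set i} (gen : I → Group.Carrier 𝔾) where
  private module 𝔾 = Group 𝔾

  data Generated : 𝔾.Carrier → Set (c ⊔ i) where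
    generator : ∀ j → Generated (gen j)
    identity  : Generated 𝔾.ε
    product   : ∀ {x y} → Generated x → Generated y → Generated (x 𝔾.∙ y)
    inverse   : ∀ {x} → Generated x → Generated (x 𝔾.⁻¹)

  GeneratedSubgroup : Group (c ⊔ i) ℓ
  GeneratedSubgroup = record
    { Carrier = Σ 𝔾.Carrier Generated
    ; _≈_     = λ x y → proj₁ x 𝔾.≈ proj₁ y
    ; _∙_     = λ (x , p) (y , q) → x 𝔾.∙ y , product p q
    ; ε       = 𝔾.ε , identity
    ; _⁻¹     = λ (x , p) → x 𝔾.⁻¹ , inverse p
    ; isGroup = record
      { isMonoid = record
        { isSemigroup = record
          { isMagma = record
            { isEquivalence = record { refl = 𝔾.refl ; sym = 𝔾.sym ; trans = 𝔾.trans }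
            ; ∙-cong = 𝔾.∙-cong
            }
          ; assoc = λ (x , _) (y , _) (z , _) → 𝔾.assoc x y z
          }
        ; identity = (λ (x , _) → 𝔾.identityˡ x) , (λ (x , _) → 𝔾.identityʳ x)
        }
      ; inverse = (λ (x , _) → 𝔾.inverseˡ x) , (λ (x , _) → 𝔾.inverseʳ x)
      ; ⁻¹-cong = 𝔾.⁻¹-cong
      }
    }

module _ (G : Graph) where

  ToggleGroup : Group 0ℓ 0ℓ
  ToggleGroup = GeneratedSubgroup (SymmetricGroup (𝒮 G)) (toggle-↔ G)

  t : E G → Group.Carrier ToggleGroup
  t e = toggle-↔ G e , generator e

  -- The cut is the partition of the vertices into A and its complement.
  Crosses : Subset (#V G) → E G → Set
  Crosses A e = let (u , v) = ends G e in (u ∈ A × v ∈ ∁ A) ⊎ (u ∈ ∁ A × v ∈ A)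

  IsCutSet : Subset (#E G) → Set
  IsCutSet D = ∃[ A ] (∀ e → e ∈ D ⇔ Crosses A e)

  -- A co-circuit is a circuit of the dual matroid, i.e. an inclusion-minimal
  -- nonempty set of edges across a cut.  Minimality matters: in the path with edges
  -- ab and bc, both edges cross the cut {b} | {a , c}, yet no co-circuit contains both.
  IsCocircuit : Subset (#E G) → Set
  IsCocircuit D =
    IsCutSet D × Nonempty D ×
    (∀ D′ → IsCutSet D′ → Nonempty D′ → D′ ⊆ D → D′ ≡ D)

{-# OPTIONS --safe #-}
module Submission where

-- Write X△e for X with e toggled.  Supersets of spanning sets are spanning, so on a
-- square X, X△e, X△f, X△{e,f} the two toggles commute unless exactly three corners are
-- spanning, and then their product is a 3-cycle.  Such a square has a bottom corner B
-- that does not span although B ∪ {e} and B ∪ {f} do.  Then the cut-set of the component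
-- of B containing an end of e is a co-circuit through e and f; conversely, the complement
-- of a co-circuit through e and f is such a B.

open import Defs
open import Algebra.Bundles using (Group)
open import Data.Bool using (not)
open import Data.Bool.Properties using (not-involutive)
open import Data.Fin using (Fin; zero; suc; _≟_)
open import Data.Fin.Subset
  using (Subset; _∈_; _∉_; _⊆_; _∪_; _-_; ⁅_⁆; ∁; ⊤; Nonempty; inside; outside)
open import Data.Fin.Subset.Properties
  using (_∈?_; x∈⁅x⁆; q⊆p∪q; p⊆p∪q; ∪-identityʳ; p─⊥≡p; ∈⊤; x∈p⇒x∉∁p; x∈∁p⇒x∉p; x∉∁p⇒x∈p; x∉p⇒x∈∁p;
         ⊆-antisym)
open import Data.List using ([]; _∷_; filter; length; deduplicate; allFin)
open import Data.List.Membership.Propositional using (find) renaming (_∈_ to _∈ₗ_)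
open import Data.List.Membership.Propositional.Properties using (∈-AllPairs₂; ∈-allFin)
open import Data.List.Properties
  using (filter-all; filter-accept; filter-reject; filter-complete; length-filter; length-deduplicate)
open import Data.List.Relation.Unary.All as All using ()
open import Data.List.Relation.Unary.All.Properties using (all-filter)
open import Data.List.Relation.Unary.AllPairs using (AllPairs)
open import Data.List.Relation.Unary.Any as Any using (Any)
open import Data.List.Relation.Unary.Any.Properties using (deduplicate⁺)
import Data.List.Relation.Unary.Unique.DecSetoid.Properties as Unique
open import Data.Nat using (ℕ; _≤_)
import Data.Nat.Properties as ℕ
open import Data.Product using (∃-syntax; _×_; _,_; proj₁; proj₂)
open import Data.Sum using (_⊎_; inj₁; inj₂)
open import Data.Vec using (_∷_; here; there; tabulate; updateAt)
open import Data.Vec.Properties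
  using (updateAt-minimal; updateAt-updateAt-local; updateAt-id; updateAt-commutes;
         lookup⇒[]=; []=⇒lookup; lookup∘tabulate)
open import Function using (_∘_; id; _⇔_; mk⇔; Equivalence)
open import Level using (0ℓ)
open import Relation.Binary using (Rel; Decidable; IsEquivalence; _⇒_)
import Relation.Binary.Construct.Closure.Equivalence as Eq
open import Relation.Binary.Construct.Closure.ReflexiveTransitive as Star using (_◅_)
open import Relation.Binary.Construct.Closure.Symmetric using (fwd; bwd)
open import Relation.Binary.PropositionalEquality
  using (_≡_; _≢_; refl; sym; trans; cong; subst; module ≡-Reasoning)
open import Relation.Nullary using (¬_; Dec; yes; no; does; contradiction)
open import Relation.Nullary.Decidable using (¬?; dec-true; decidable-stable; _×-dec_; _⊎-dec_)
open import Relation.Unary using (Pred)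
import Relation.Unary as U

-- Toggling an element

-- A single operation for adding and removing, so that both branches of `toggle` are handled
-- together and the involution and commutation laws need no membership hypotheses.
flip : ∀ {n} → Fin n → Subset n → Subset n
flip x p = updateAt p x not

flip-involutive : ∀ {n} (x : Fin n) p → flip x (flip x p) ≡ p
flip-involutive x p =
  trans (updateAt-updateAt-local x {h = id} p (not-involutive _)) (updateAt-id x p)

flip-comm : ∀ {n} {x y : Fin n} → x ≢ y → ∀ p → flip x (flip y p) ≡ flip y (flip x p)
flip-comm x≢y p = updateAt-commutes _ _ x≢y p

∪⁅⁆≡flip : ∀ {n} {x : Fin n} {p} → x ∉ p → p ∪ ⁅ x ⁆ ≡ flip x p
∪⁅⁆≡flip {x = zero}  {inside  ∷ p} x∉p = contradiction here x∉p
∪⁅⁆≡flip {x = zero}  {outside ∷ p} x∉p = cong (inside ∷_) (∪-identityʳ p)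
∪⁅⁆≡flip {x = suc x} {inside  ∷ p} x∉p = cong (inside  ∷_) (∪⁅⁆≡flip (x∉p ∘ there))
∪⁅⁆≡flip {x = suc x} {outside ∷ p} x∉p = cong (outside ∷_) (∪⁅⁆≡flip (x∉p ∘ there))

-≡flip : ∀ {n} {x : Fin n} {p} → x ∈ p → p - x ≡ flip x p
-≡flip {x = zero}  {_ ∷ p}       here        = cong (outside ∷_) (p─⊥≡p p)
-≡flip {x = suc x} {inside  ∷ p} (there x∈p) = cong (inside  ∷_) (-≡flip x∈p)
-≡flip {x = suc x} {outside ∷ p} (there x∈p) = cong (outside ∷_) (-≡flip x∈p)

module _ {n : ℕ} {x : Fin n} {p : Subset n} where

  x∈flip : x ∉ p → x ∈ flip x p
  x∈flip x∉p = subst (x ∈_) (∪⁅⁆≡flip x∉p) (q⊆p∪q p ⁅ x ⁆ (x∈⁅x⁆ x))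

  x∉flip : x ∈ p → x ∉ flip x p
  x∉flip x∈p = subst (x ∉_) (-≡flip x∈p) (x∉p-x p)

  p⊆flip : x ∉ p → p ⊆ flip x p
  p⊆flip x∉p = subst (p ⊆_) (∪⁅⁆≡flip x∉p) (p⊆p∪q ⁅ x ⁆)

  flip≢ : flip x p ≢ p
  flip≢ eq with x ∈? p
  ... | yes x∈p = x∉flip x∈p (subst (x ∈_) (sym eq) x∈p)
  ... | no  x∉p = x∉p (subst (x ∈_) eq (x∈flip x∉p))

∈flip⁺ : ∀ {n} {x y : Fin n} {p} → x ≢ y → x ∈ p → x ∈ flip y p
∈flip⁺ x≢y x∈p = updateAt-minimal _ _ _ x≢y x∈p

∈flip⁻ : ∀ {n} {x y : Fin n} {p} → x ≢ y → x ∈ flip y p → x ∈ p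
∈flip⁻ x≢y x∈ = subst (_ ∈_) (flip-involutive _ _) (∈flip⁺ x≢y x∈)

-- Subsets given by decidable predicates

module _ {n : ℕ} {P : Pred (Fin n) 0ℓ} (P? : U.Decidable P) where

  comprehension : Subset n
  comprehension = tabulate (does ∘ P?)

  ∈-comprehension⁺ : ∀ {x} → P x → x ∈ comprehension
  ∈-comprehension⁺ {x} px =
    lookup⇒[]= x _ (trans (lookup∘tabulate _ x) (dec-true (P? x) px))

  ∈-comprehension⁻ : ∀ {x} → x ∈ comprehension → P x
  ∈-comprehension⁻ {x} x∈ with P? x | trans (sym (lookup∘tabulate (does ∘ P?) x)) ([]=⇒lookup x∈)
  ... | yes px | _  = px
  ... | no  _  | ()

-- Numbers of equivalence classes

module _ {A : Set} {P Q : Pred A 0ℓ} (P? : U.Decidable P) (Q? : U.Decidable Q) where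

  filter-comm : ∀ xs → filter P? (filter Q? xs) ≡ filter Q? (filter P? xs)
  filter-comm []       = refl
  filter-comm (x ∷ xs) with P? x | Q? x
  ... | yes p | yes q rewrite filter-accept P? {xs = filter Q? xs} p
                            | filter-accept Q? {xs = filter P? xs} q = cong (x ∷_) (filter-comm xs)
  ... | yes p | no ¬q rewrite filter-reject Q? {xs = filter P? xs} ¬q = filter-comm xs
  ... | no ¬p | yes q rewrite filter-reject P? {xs = filter Q? xs} ¬p = filter-comm xs
  ... | no ¬p | no ¬q = filter-comm xs

  filter-absorb : P U.⊆ Q → ∀ xs → filter P? (filter Q? xs) ≡ filter P? xs
  filter-absorb P⊆Q xs =
    trans (filter-comm xs) (filter-all Q? (All.map P⊆Q (all-filter P? xs)))

module _ {A : Set} {R : Rel A 0ℓ} (R-eq : IsEquivalence R) (R? : Decidable R) where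
  private module R = IsEquivalence R-eq

  -- `P` is constant on classes of `R`, so filtering keeps or drops each class whole. In particular,
  -- when `x` fails `P`, removing its class first changes nothing.
  deduplicate-filter : {P : Pred A 0ℓ} (P? : U.Decidable P) → (∀ {x y} → R x y → P x → P y) →
                       ∀ xs → deduplicate R? (filter P? xs) ≡ filter P? (deduplicate R? xs)
  deduplicate-filter P? resp []       = refl
  deduplicate-filter P? resp (x ∷ xs) with P? x
  ... | yes p = cong (x ∷_) (trans (cong (filter (¬? ∘ R? x)) (deduplicate-filter P? resp xs))
                                   (filter-comm (¬? ∘ R? x) P? (deduplicate R? xs)))
  ... | no ¬p = trans (deduplicate-filter P? resp xs)
                      (sym (filter-absorb P? (¬? ∘ R? x) (λ p r → ¬p (resp (R.sym r) p))
                                         (deduplicate R? xs)))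

  -- Each filter inside `deduplicate` can only shorten the list, so equal lengths force every one of
  -- them to drop nothing.
  deduplicate-complete : ∀ xs → length (deduplicate R? xs) ≡ length xs → deduplicate R? xs ≡ xs
  deduplicate-complete []       _  = refl
  deduplicate-complete (x ∷ xs) eq =
    cong (x ∷_) (trans (filter-complete (¬? ∘ R? x) (ℕ.≤-antisym f≤d d≤f))
                       (deduplicate-complete xs (ℕ.≤-antisym (length-deduplicate R? xs) n≤d)))
    where
    f = filter (¬? ∘ R? x) (deduplicate R? xs)

    f≤d : length f ≤ length (deduplicate R? xs)
    f≤d = length-filter (¬? ∘ R? x) (deduplicate R? xs)

    n≤d : length xs ≤ length (deduplicate R? xs)
    n≤d = ℕ.≤-trans (ℕ.≤-reflexive (sym (ℕ.suc-injective eq))) f≤d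

    d≤f : length (deduplicate R? xs) ≤ length f
    d≤f = ℕ.≤-trans (length-deduplicate R? xs) (ℕ.≤-reflexive (sym (ℕ.suc-injective eq)))

  deduplicate-distinct : ∀ xs → AllPairs (λ x y → ¬ R x y) (deduplicate R? xs)
  deduplicate-distinct = Unique.deduplicate-! (record
    { isDecEquivalence = record { isEquivalence = R-eq ; _≟_ = R? } })

module _ {A : Set} {R T : Rel A 0ℓ}
         (R-eq : IsEquivalence R) (R? : Decidable R)
         (T-eq : IsEquivalence T) (T? : Decidable T) (R⇒T : R ⇒ T) where
  private
    module R = IsEquivalence R-eq
    module T = IsEquivalence T-eq

  -- Whatever is dropped for being `R`-related to `x` would be dropped anyway for being `T`-related
  -- to it. The filter against `x` can be moved through `dedupT` because it respects the classes of
  -- `T`.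
  deduplicate-coarsen : ∀ xs → deduplicate T? (deduplicate R? xs) ≡ deduplicate T? xs
  deduplicate-coarsen []       = refl
  deduplicate-coarsen (x ∷ xs) = cong (x ∷_) (begin
    filter ¬Tx (dedupT (filter ¬Rx (dedupR xs)))
      ≡⟨ T-filter (filter ¬Rx (dedupR xs)) ⟨
    dedupT (filter ¬Tx (filter ¬Rx (dedupR xs)))
      ≡⟨ cong dedupT (filter-absorb ¬Tx ¬Rx (λ ¬t r → ¬t (R⇒T r)) (dedupR xs)) ⟩
    dedupT (filter ¬Tx (dedupR xs))
      ≡⟨ T-filter (dedupR xs) ⟩
    filter ¬Tx (dedupT (dedupR xs))
      ≡⟨ cong (filter ¬Tx) (deduplicate-coarsen xs) ⟩
    filter ¬Tx (dedupT xs) ∎)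
    where
    open ≡-Reasoning
    dedupR = deduplicate R?
    dedupT = deduplicate T?
    ¬Rx = ¬? ∘ R? x
    ¬Tx = ¬? ∘ T? x

    T-filter : ∀ ys → dedupT (filter ¬Tx ys) ≡ filter ¬Tx (dedupT ys)
    T-filter = deduplicate-filter T-eq T? ¬Tx (λ t ¬xy xz → ¬xy (T.trans xz (T.sym t)))

  deduplicate-antitone : ∀ xs → length (deduplicate T? xs) ≤ length (deduplicate R? xs)
  deduplicate-antitone xs =
    subst (λ zs → length zs ≤ _) (deduplicate-coarsen xs) (length-deduplicate T? (deduplicate R? xs))

  -- Equal counts mean that deduplicating the `R`-representatives by `T` removes none of them, so
  -- different representatives are never `T`-related. The representatives of `x` and `y` are
  -- `T`-related, hence equal.
  same-length⇒coarse⇒fine : ∀ {xs} → length (deduplicate R? xs) ≡ length (deduplicate T? xs) →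
                            ∀ {x y} → x ∈ₗ xs → y ∈ₗ xs → T x y → R x y
  same-length⇒coarse⇒fine {xs} eq {x} {y} x∈ y∈ t with find (representative x∈) | find (representative y∈)
    where
    representative : ∀ {z} → z ∈ₗ xs → Any (R z) (deduplicate R? xs)
    representative z∈ =
      deduplicate⁺ R? (λ r s → R.trans s (R.sym r)) (Any.map R.reflexive z∈)
  ... | x′ , x′∈ , rx | y′ , y′∈ , ry = conclude (∈-AllPairs₂ distinct x′∈ y′∈)
    where
    distinct : AllPairs (λ x y → ¬ T x y) (deduplicate R? xs)
    distinct = subst (AllPairs _)
      (deduplicate-complete T-eq T? _ (trans (cong length (deduplicate-coarsen xs)) (sym eq)))
      (deduplicate-distinct T-eq T? (deduplicate R? xs))

    t′ : T x′ y′
    t′ = T.trans (T.sym (R⇒T rx)) (T.trans t (R⇒T ry))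

    conclude : x′ ≡ y′ ⊎ ¬ T x′ y′ ⊎ ¬ T y′ x′ → R x y
    conclude (inj₁ refl)      = R.trans rx (R.sym ry)
    conclude (inj₂ (inj₁ ¬t)) = contradiction t′ ¬t
    conclude (inj₂ (inj₂ ¬t)) = contradiction (T.sym t′) ¬t

-- Connectivity and spanning edge sets

module _ (G : Graph) where

  private
    variable
      S T : Subset (#E G)
      u v : V G

    connected-isEquivalence : ∀ S → IsEquivalence (Connected G S)
    connected-isEquivalence S = Eq.isEquivalence (Adjacent G S)

    module C {S} = IsEquivalence (connected-isEquivalence S)

  end₁ end₂ : E G → V G
  end₁ = proj₁ ∘ ends G
  end₂ = proj₂ ∘ ends G

  EndsConnected : Subset (#E G) → E G → Set
  EndsConnected S g = Connected G S (end₁ g) (end₂ g)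

  -- The form of `IsSpanning` used for reasoning: every edge of the graph can be replaced by a walk
  -- in `S`. Unlike an equation between component counts, it is visibly monotone.
  Spans : Subset (#E G) → Set
  Spans S = ∀ g → EndsConnected S g

  -- Connectedness in `T` is an equivalence relation, so it extends from single edges of `S` to
  -- walks.
  connected-fold : (∀ {g} → g ∈ S → EndsConnected T g) → Connected G S u v → Connected G T u v
  connected-fold {T = T} h =
    Eq.fold (connected-isEquivalence T) (λ { (g , g∈S , refl) → h g∈S })

  edge-connected : ∀ {g} → g ∈ S → EndsConnected S g
  edge-connected g∈S = Eq.return (_ , g∈S , refl)

  connected-mono : S ⊆ T → Connected G S u v → Connected G T u v
  connected-mono S⊆T = connected-fold (edge-connected ∘ S⊆T)

  spans-mono : S ⊆ T → Spans S → Spans T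
  spans-mono S⊆T spans g = connected-mono S⊆T (spans g)

  -- Connectedness in `S` refines connectedness in `⊤`; with equally many classes the two relations
  -- coincide.
  spanning⇒spans : IsSpanning G S → Spans S
  spanning⇒spans {S} s g = same-length⇒coarse⇒fine
    (connected-isEquivalence S) (connected? G S) (connected-isEquivalence ⊤) (connected? G ⊤)
    (connected-mono (λ _ → ∈⊤)) s (∈-allFin _) (∈-allFin _) (edge-connected ∈⊤)

  spans⇒spanning : Spans S → IsSpanning G S
  spans⇒spanning {S} spans = ℕ.≤-antisym
    (antitone ⊤ S (connected-fold (λ {g} _ → spans g)))
    (antitone S ⊤ (connected-mono (λ _ → ∈⊤)))
    where
    antitone : ∀ S T → Connected G S ⇒ Connected G T → #components G T ≤ #components G S
    antitone S T S⇒T = deduplicate-antitone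
      (connected-isEquivalence S) (connected? G S) (connected-isEquivalence T) (connected? G T)
      S⇒T (allFin (#V G))

  -- Cuts

  crosses? : ∀ A g → Dec (Crosses G A g)
  crosses? A g = (end₁ g ∈? A ×-dec end₂ g ∈? ∁ A) ⊎-dec (end₁ g ∈? ∁ A ×-dec end₂ g ∈? A)

  cutSet : Subset (#V G) → Subset (#E G)
  cutSet A = comprehension (crosses? A)

  cutSet-isCutSet : ∀ A → IsCutSet G (cutSet A)
  cutSet-isCutSet A = A , λ _ → mk⇔ (∈-comprehension⁻ (crosses? A)) (∈-comprehension⁺ (crosses? A))

  Avoids : Subset (#E G) → Subset (#V G) → Set
  Avoids S A = ∀ {g} → g ∈ S → ¬ Crosses G A g

  avoids⇒closed : ∀ {A} → Avoids S A → Connected G S u v → u ∈ A → v ∈ A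
  avoids⇒closed             av Star.ε u∈A = u∈A
  avoids⇒closed {A = A} av (fwd (g , g∈S , refl) ◅ w) u∈A with end₂ g ∈? A
  ... | yes x∈A = avoids⇒closed av w x∈A
  ... | no  x∉A = contradiction (inj₁ (u∈A , x∉p⇒x∈∁p x∉A)) (av g∈S)
  avoids⇒closed {A = A} av (bwd (g , g∈S , refl) ◅ w) u∈A with end₁ g ∈? A
  ... | yes x∈A = avoids⇒closed av w x∈A
  ... | no  x∉A = contradiction (inj₂ (x∉p⇒x∈∁p x∉A , u∈A)) (av g∈S)

  crosses⇒¬endsConnected : ∀ {A g} → Avoids S A → Crosses G A g → ¬ EndsConnected S g
  crosses⇒¬endsConnected av (inj₁ (x∈A , y∈∁A)) c = x∈∁p⇒x∉p y∈∁A (avoids⇒closed av c x∈A)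
  crosses⇒¬endsConnected av (inj₂ (x∈∁A , y∈A)) c = x∈∁p⇒x∉p x∈∁A (avoids⇒closed av (C.sym c) y∈A)

  component : Subset (#E G) → V G → Subset (#V G)
  component S u = comprehension (connected? G S u)

  ∈-component⁺ : Connected G S u v → v ∈ component S u
  ∈-component⁺ {S} {u} = ∈-comprehension⁺ (connected? G S u)

  ∈-component⁻ : v ∈ component S u → Connected G S u v
  ∈-component⁻ {S = S} {u = u} = ∈-comprehension⁻ (connected? G S u)

  avoids-component : ∀ u → Avoids S (component S u)
  avoids-component u g∈S (inj₁ (x∈ , y∈∁)) =
    x∈∁p⇒x∉p y∈∁ (∈-component⁺ (C.trans (∈-component⁻ x∈) (edge-connected g∈S)))
  avoids-component u g∈S (inj₂ (x∈∁ , y∈)) =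
    x∈∁p⇒x∉p x∈∁ (∈-component⁺ (C.trans (∈-component⁻ y∈) (C.sym (edge-connected g∈S))))

  crosses-component : ∀ {g} → ¬ EndsConnected S g → Crosses G (component S (end₁ g)) g
  crosses-component ¬c = inj₁ (∈-component⁺ C.refl , x∉p⇒x∈∁p (¬c ∘ ∈-component⁻))

  -- Used by contradiction to show that `g` crosses: otherwise `flip g S` would still avoid the cut,
  -- and so could not connect the ends of any crossing edge.
  avoids-flip : ∀ {A g} → Avoids S A → ¬ Crosses G A g → Avoids (flip g S) A
  avoids-flip {g = g} av ¬cr {h} h∈ with h ≟ g
  ... | yes refl = ¬cr
  ... | no  h≢g  = av (∈flip⁻ h≢g h∈)

  -- If S did not span, the cut-set of one of its components would be a nonempty
  -- subset of D avoiding e.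
  cocircuit⇒spans : ∀ {D e} → IsCocircuit G D → e ∈ D → ∁ D ⊆ S → e ∈ S → Spans S
  cocircuit⇒spans {S = S} {D} {e} (_ , _ , minimal) e∈D ∁D⊆S e∈S g =
    decidable-stable (connected? G S _ _) λ ¬c →
      let A      = component S (end₁ g)
          g∈     = ∈-comprehension⁺ (crosses? A) (crosses-component ¬c)
          cut⊆D  = λ {h} h∈ → x∉∁p⇒x∈p λ h∈∁D →
                     avoids-component {S = S} (end₁ g) {h} (∁D⊆S h∈∁D) (∈-comprehension⁻ (crosses? A) h∈)
          cut≡D  = minimal (cutSet A) (cutSet-isCutSet A) (g , g∈) cut⊆D
      in avoids-component {S = S} (end₁ g) e∈S
           (∈-comprehension⁻ (crosses? A) (subst (e ∈_) (sym cut≡D) e∈D))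

  -- No edge outside `D` crosses the cut defining `D`, so these edges cannot connect the ends of an
  -- edge of `D`, and `D` has one.
  cocircuit⇒¬spans-∁ : ∀ {D} → IsCocircuit G D → ¬ Spans (∁ D)
  cocircuit⇒¬spans-∁ ((A , cut) , (g , g∈D) , _) spans =
    crosses⇒¬endsConnected {A = A} (λ {h} h∈∁D cr → x∈∁p⇒x∉p h∈∁D (Equivalence.from (cut h) cr))
      (Equivalence.to (cut g) g∈D) (spans g)

  -- The co-circuit obtained from a non-spanning corner

  spans-flip⇒spans : ∀ {e} → Spans (flip e S) → EndsConnected S e → Spans S
  spans-flip⇒spans {S = S} {e} spans c g = connected-fold step (spans g)
    where
    step : ∀ {h} → h ∈ flip e S → EndsConnected S h
    step {h} h∈ with h ≟ e
    ... | yes refl = c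
    ... | no  h≢e  = edge-connected (∈flip⁻ h≢e h∈)

  -- Cut the walk at its first traversal of `e`, if there is one: the part before it lies in `S` and
  -- stops at an end of `e`.
  connected-flip-split : ∀ {e z} → Connected G (flip e S) z (end₁ e) →
                         Connected G S z (end₁ e) ⊎ Connected G S z (end₂ e)
  connected-flip-split Star.ε = inj₁ Star.ε
  connected-flip-split {e = e} (fwd (h , h∈ , refl) ◅ w) with h ≟ e | connected-flip-split w
  ... | yes refl | _      = inj₁ Star.ε
  ... | no h≢e   | inj₁ p = inj₁ (fwd (h , ∈flip⁻ h≢e h∈ , refl) ◅ p)
  ... | no h≢e   | inj₂ p = inj₂ (fwd (h , ∈flip⁻ h≢e h∈ , refl) ◅ p)
  connected-flip-split {e = e} (bwd (h , h∈ , refl) ◅ w) with h ≟ e | connected-flip-split w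
  ... | yes refl | _      = inj₂ Star.ε
  ... | no h≢e   | inj₁ p = inj₁ (bwd (h , ∈flip⁻ h≢e h∈ , refl) ◅ p)
  ... | no h≢e   | inj₂ p = inj₂ (bwd (h , ∈flip⁻ h≢e h∈ , refl) ◅ p)

  module _ {B : Subset (#E G)} {e f : E G} (e∉B : e ∉ B)
           (spans-e : Spans (flip e B)) (spans-f : Spans (flip f B)) (¬spans : ¬ Spans B) where
    private
      A = component B (end₁ e)
      D = cutSet A

      ¬e-connected : ¬ EndsConnected B e
      ¬e-connected = ¬spans ∘ spans-flip⇒spans spans-e

      e-crosses : Crosses G A e
      e-crosses = crosses-component ¬e-connected

      -- If `f` did not cross, `flip f B` would avoid the cut that separates the ends of `e`,
      -- although it spans.
      f-crosses : Crosses G A f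
      f-crosses = decidable-stable (crosses? A f) λ ¬cr →
        crosses⇒¬endsConnected (avoids-flip (avoids-component (end₁ e)) ¬cr) e-crosses (spans-f e)

      -- Without `e`, its component in `flip e B` falls into the parts of its two ends. A vertex
      -- outside the part `A` of the first end must therefore lie with the second.
      ∉component⇒connected : ∀ {x y} → Connected G (flip e B) x y → x ∈ A → y ∉ A →
                             Connected G B y (end₂ e)
      ∉component⇒connected c x∈A y∉A
        with connected-flip-split (C.sym (C.trans (connected-mono (p⊆flip e∉B) (∈-component⁻ x∈A)) c))
      ... | inj₁ p = contradiction (∈-component⁺ (C.sym p)) y∉A
      ... | inj₂ p = p

      -- The end of `h` inside `A` is joined in `B` to the first end of `e` and the other to the
      -- second, so `h` serves as a bridge in place of `e`.
      reconnect : ∀ {h} → Crosses G A h → EndsConnected (flip h B) e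
      reconnect {h} cr = go cr
        where
        h∉B : h ∉ B
        h∉B h∈B = avoids-component (end₁ e) h∈B cr

        lift : ∀ {x y} → Connected G B x y → Connected G (flip h B) x y
        lift = connected-mono (p⊆flip h∉B)

        go : Crosses G A h → EndsConnected (flip h B) e
        go (inj₁ (x∈A , y∈∁A)) =
          C.trans (lift (∈-component⁻ x∈A)) (C.trans (edge-connected (x∈flip h∉B))
            (lift (∉component⇒connected (spans-e h) x∈A (x∈∁p⇒x∉p y∈∁A))))
        go (inj₂ (x∈∁A , y∈A)) =
          C.trans (lift (∈-component⁻ y∈A)) (C.trans (C.sym (edge-connected (x∈flip h∉B)))
            (lift (∉component⇒connected (C.sym (spans-e h)) y∈A (x∈∁p⇒x∉p x∈∁A))))

      -- As `D′` lies in `D`, no edge of `B` crosses `A′`. Since `flip e B` connects the ends of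
      -- some crossing edge `g`, the edge `e` must cross `A′`. Since each `h` in `D` reconnects the
      -- ends of `e`, `h` must cross too.
      minimal : ∀ D′ → IsCutSet G D′ → Nonempty D′ → D′ ⊆ D → D′ ≡ D
      minimal D′ (A′ , cut) (g , g∈D′) D′⊆D = ⊆-antisym D′⊆D D⊆D′
        where
        avoids : Avoids B A′
        avoids {h} h∈B cr = avoids-component (end₁ e) h∈B
          (∈-comprehension⁻ (crosses? A) (D′⊆D (Equivalence.from (cut h) cr)))

        e-crosses′ : Crosses G A′ e
        e-crosses′ = decidable-stable (crosses? A′ e) λ ¬cr →
          crosses⇒¬endsConnected (avoids-flip avoids ¬cr) (Equivalence.to (cut g) g∈D′) (spans-e g)

        D⊆D′ : D ⊆ D′
        D⊆D′ {h} h∈D = Equivalence.from (cut h) (decidable-stable (crosses? A′ h) λ ¬cr →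
          crosses⇒¬endsConnected (avoids-flip avoids ¬cr) e-crosses′
            (reconnect (∈-comprehension⁻ (crosses? A) h∈D)))

    cocircuit-through : ∃[ D ] (IsCocircuit G D × e ∈ D × f ∈ D)
    cocircuit-through = D , (cutSet-isCutSet A , (e , e∈D) , minimal) , e∈D ,
                        ∈-comprehension⁺ (crosses? A) f-crosses
      where e∈D = ∈-comprehension⁺ (crosses? A) e-crosses

  -- Toggles

  toggle-flip : ∀ e s (s′ : IsSpanning G (flip e S)) → toggle G e (S , s) ≡ (flip e S , s′)
  toggle-flip {S} e s s′ = go (e ∈? S)
    where
    go : Dec (e ∈ S) → toggle G e (S , s) ≡ (flip e S , s′)
    go (yes e∈S) = trans (toggle-remove G e s e∈S (subst (IsSpanning G) (sym (-≡flip e∈S)) s′))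
                         (𝒮-≡ G (-≡flip e∈S))
    go (no  e∉S) = trans (toggle-add G e s e∉S (subst (IsSpanning G) (sym (∪⁅⁆≡flip e∉S)) s′))
                         (𝒮-≡ G (∪⁅⁆≡flip e∉S))

  toggle-fix : ∀ e s → ¬ IsSpanning G (flip e S) → toggle G e (S , s) ≡ (S , s)
  toggle-fix {S} e s ¬s′ = go (e ∈? S)
    where
    go : Dec (e ∈ S) → toggle G e (S , s) ≡ (S , s)
    go (yes e∈S) = toggle-remove-fix G e s e∈S (¬s′ ∘ subst (IsSpanning G) (-≡flip e∈S))
    go (no  e∉S) = toggle-add-fix G e s e∉S (¬s′ ∘ subst (IsSpanning G) (∪⁅⁆≡flip e∉S))

  -- Squares of edge sets under two toggles

  module _ (e f : E G) (e≢f : e ≢ f) where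
    private
      te = toggle G e
      tf = toggle G f

    Involutive : Set
    Involutive = ∀ X → te (tf (te (tf X))) ≡ X

    -- `X` is the corner opposite the one filled in. As `X` varies, any of the four corners of a
    -- square can be the one in question.
    SquaresFill : Set
    SquaresFill = ∀ X → IsSpanning G X → IsSpanning G (flip e X) → IsSpanning G (flip f X) →
                  IsSpanning G (flip e (flip f X))

    -- With the fourth corner missing, the inner `te` fixes `flip f X`, so the two `tf` cancel and
    -- the last `te` moves `X` to `flip e X`, which differs from `X`.
    involutive⇒squaresFill : Involutive → SquaresFill
    involutive⇒squaresFill inv X s se sf =
      decidable-stable (isSpanning? G _) λ ¬sef → flip≢ (cong proj₁ (trans (sym (loop ¬sef)) (inv (X , s))))
      where
      open ≡-Reasoning
      loop : ¬ IsSpanning G (flip e (flip f X)) → te (tf (te (tf (X , s)))) ≡ (flip e X , se)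
      loop ¬sef = begin
        te (tf (te (tf (X , s))))     ≡⟨ cong (te ∘ tf ∘ te) (toggle-flip f s sf) ⟩
        te (tf (te (flip f X , sf)))  ≡⟨ cong (te ∘ tf) (toggle-fix e sf ¬sef) ⟩
        te (tf (flip f X , sf))       ≡⟨ cong (te ∘ tf) (toggle-flip f s sf) ⟨
        te (tf (tf (X , s)))          ≡⟨ cong te (toggle-involutive G f (X , s)) ⟩
        te (X , s)                    ≡⟨ toggle-flip e s se ⟩
        (flip e X , se)               ∎

    -- If just one neighbour of `X` spans, the corner opposite `X` cannot: filling the square from
    -- the spanning neighbour would make the other neighbour span. So the second toggle fixes what
    -- the first one produced.
    toggles-commute : SquaresFill → ∀ X → te (tf X) ≡ tf (te X)
    toggles-commute fill (X , s) = go (isSpanning? G (flip e X)) (isSpanning? G (flip f X))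
      where
      go : Dec (IsSpanning G (flip e X)) → Dec (IsSpanning G (flip f X)) → te (tf (X , s)) ≡ tf (te (X , s))
      go (yes se) (yes sf) =
        trans (cong te (toggle-flip f s sf)) (trans (toggle-flip e sf sef)
        (trans (𝒮-≡ G (flip-comm e≢f X))
        (sym (trans (cong tf (toggle-flip e s se)) (toggle-flip f se sfe)))))
        where
        sef = fill X s se sf
        sfe = subst (IsSpanning G) (flip-comm e≢f X) sef
      go (yes se) (no ¬sf) =
        trans (cong te (toggle-fix f s ¬sf)) (trans (toggle-flip e s se)
        (sym (trans (cong tf (toggle-flip e s se)) (toggle-fix f se ¬sfe))))
        where
        ¬sfe : ¬ IsSpanning G (flip f (flip e X))
        ¬sfe sfe = ¬sf (subst (IsSpanning G)
          (trans (flip-comm e≢f (flip e X)) (cong (flip f) (flip-involutive e X)))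
          (fill (flip e X) se (subst (IsSpanning G) (sym (flip-involutive e X)) s) sfe))
      go (no ¬se) (yes sf) =
        trans (cong te (toggle-flip f s sf)) (trans (toggle-fix e sf ¬sef)
        (sym (trans (cong tf (toggle-fix e s ¬se)) (toggle-flip f s sf))))
        where
        ¬sef : ¬ IsSpanning G (flip e (flip f X))
        ¬sef sef = ¬se (subst (IsSpanning G) (cong (flip e) (flip-involutive f X))
          (fill (flip f X) sf sef (subst (IsSpanning G) (sym (flip-involutive f X)) s)))
      go (no ¬se) (no ¬sf) =
        trans (cong te (toggle-fix f s ¬sf)) (trans (toggle-fix e s ¬se)
        (sym (trans (cong tf (toggle-fix e s ¬se)) (toggle-fix f s ¬sf))))

    squaresFill⇒involutive : SquaresFill → Involutive
    squaresFill⇒involutive fill X = begin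
      te (tf (te (tf X)))  ≡⟨ cong te (toggles-commute fill (tf X)) ⟨
      te (te (tf (tf X)))  ≡⟨ toggle-involutive G e (tf (tf X)) ⟩
      tf (tf X)            ≡⟨ toggle-involutive G f X ⟩
      X                    ∎
      where open ≡-Reasoning

    -- Fillable squares and co-circuits

    NoCommonCocircuit : Set
    NoCommonCocircuit = ¬ (∃[ D ] (IsCocircuit G D × e ∈ D × f ∈ D))

    -- In the square above the complement of `D`, both middle corners span by minimality of `D`,
    -- hence so does the top. Filling would make the complement of `D` span.
    squaresFill⇒noCommonCocircuit : SquaresFill → NoCommonCocircuit
    squaresFill⇒noCommonCocircuit fill (D , cocircuit , e∈D , f∈D) =
      cocircuit⇒¬spans-∁ cocircuit (spanning⇒spans
        (subst (IsSpanning G) X-ef≡B (fill X (spans⇒spanning (spans-mono (p⊆flip f∉B+e) spans-e))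
          (spans⇒spanning (subst Spans (sym X-e≡B+f) spans-f))
          (spans⇒spanning (subst Spans (sym X-f≡B+e) spans-e)))))
      where
      B = ∁ D
      -- The top corner is taken as `X` so that the corner filled in is `B`.
      X = flip f (flip e B)

      e∉B : e ∉ B
      e∉B = x∈p⇒x∉∁p e∈D

      f∉B : f ∉ B
      f∉B = x∈p⇒x∉∁p f∈D

      f∉B+e : f ∉ flip e B
      f∉B+e = f∉B ∘ ∈flip⁻ (e≢f ∘ sym)

      spans-e : Spans (flip e B)
      spans-e = cocircuit⇒spans cocircuit e∈D (p⊆flip e∉B) (x∈flip e∉B)

      spans-f : Spans (flip f B)
      spans-f = cocircuit⇒spans cocircuit f∈D (p⊆flip f∉B) (x∈flip f∉B)

      X-f≡B+e : flip f X ≡ flip e B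
      X-f≡B+e = flip-involutive f (flip e B)

      X-e≡B+f : flip e X ≡ flip f B
      X-e≡B+f = trans (flip-comm e≢f (flip e B)) (cong (flip f) (flip-involutive e B))

      X-ef≡B : flip e (flip f X) ≡ B
      X-ef≡B = trans (cong (flip e) X-f≡B+e) (flip-involutive e B)

    -- If the corner `B` opposite `X` did not span, its neighbours `flip f X` and `flip e X` would
    -- be `flip e B` and `flip f B`, both spanning, and would yield a co-circuit through `e` and
    -- `f`.
    noCommonCocircuit⇒squaresFill : NoCommonCocircuit → SquaresFill
    noCommonCocircuit⇒squaresFill none X _ se sf =
      decidable-stable (isSpanning? G B) λ ¬sB → none (cocircuit-through
        (x∉flip (∈flip⁺ e≢f (e∈X ¬sB)))
        (subst Spans (sym (flip-involutive e (flip f X))) (spanning⇒spans sf))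
        (subst Spans (sym B+f≡X-e) (spanning⇒spans se))
        (¬sB ∘ spans⇒spanning))
      where
      B = flip e (flip f X)

      B+f≡X-e : flip f B ≡ flip e X
      B+f≡X-e = trans (cong (flip f) (flip-comm e≢f X)) (flip-involutive f (flip e X))

      -- Otherwise `B` would contain the spanning set `flip f X`. This places `e` outside `B`.
      e∈X : ¬ IsSpanning G B → e ∈ X
      e∈X ¬sB = decidable-stable (e ∈? X) λ e∉X → ¬sB
        (spans⇒spanning (spans-mono (p⊆flip (e∉X ∘ ∈flip⁻ e≢f)) (spanning⇒spans sf)))

lemma3p33 : (G : Graph) (e f : E G) → e ≢ f →
    let open Group (ToggleGroup G) in
    ((t G e ∙ t G f) ∙ (t G e ∙ t G f) ≈ ε) ⇔
    (¬ (∃[ D ] (IsCocircuit G D × e ∈ D × f ∈ D)))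
lemma3p33 G e f e≢f = mk⇔
  -- Equality of permutations is pointwise, so the group equation unfolds to `Involutive`.
  (squaresFill⇒noCommonCocircuit G e f e≢f ∘ involutive⇒squaresFill G e f e≢f)
  (squaresFill⇒involutive G e f e≢f ∘ noCommonCocircuit⇒squaresFill G e f e≢f)
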